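{- Let $G$ be a finite simple graph in which every vertex has degree at most $3$. Then for every maximal packing $S$ of $G$, there exists an independent dominating set of $G$ of size at most $3|S|$.
   Context: A set $A\subseteq V(G)$ is a dominating set of $G$ if every vertex of $G$ is in $A$ or adjacent to a vertex of $A$; an independent dominating set is a dominating set no two of whose vertices are adjacent. A packing of $G$ is a set $S\subseteq V(G)$ whose closed neighborhoods $N_G[v]=N_G(v)\cup\{v\}$, $v\in S$, are pairwise disjoint (equivalently, any two distinct vertices of $S$ are at distance at least $3$ in $G$). A maximal packing is a packing not properly contained in any other packing of $G$. -}

module Defs where

open import Data.Nat using (ℕ; _≤_)
open import Data.Bool using (Bool; true; false)
open import Data.Fin using (Fin)
open import Data.Fin.Subset using (Subset; _∈_; _⊆_; ∣_∣)
open import Data.Vec using (tabulate)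
open import Data.Product using (_×_; ∃-syntax)
open import Data.Sum using (_⊎_)
open import Relation.Nullary using (¬_)
open import Relation.Binary.PropositionalEquality using (_≡_)

record Graph (n : ℕ) : Set where
  field
    adj   : Fin n → Fin n → Bool
    sym   : ∀ u v → adj u v ≡ adj v u
    irrefl : ∀ v → adj v v ≡ false

module _ {n : ℕ} (G : Graph n) where
  open Graph G

  Adj : Fin n → Fin n → Set
  Adj u v = adj u v ≡ true

  N : Fin n → Subset n
  N v = tabulate (adj v)

  degree : Fin n → ℕ
  degree v = ∣ N v ∣

  MaxDegreeAtMost : ℕ → Set
  MaxDegreeAtMost k = ∀ v → degree v ≤ k

  InClosedNbhd : Fin n → Fin n → Set
  InClosedNbhd w v = (w ≡ v) ⊎ Adj v w

  IsDominating : Subset n → Set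
  IsDominating A = ∀ v → v ∈ A ⊎ (∃[ a ] (a ∈ A × Adj a v))

  IsIndependent : Subset n → Set
  IsIndependent A = ∀ u v → u ∈ A → v ∈ A → ¬ Adj u v

  IsIndependentDominating : Subset n → Set
  IsIndependentDominating A = IsDominating A × IsIndependent A

  IsPacking : Subset n → Set
  IsPacking S = ∀ u v → u ∈ S → v ∈ S → ¬ (u ≡ v) →
                ∀ w → ¬ (InClosedNbhd w u × InClosedNbhd w v)

  IsMaximalPacking : Subset n → Set
  IsMaximalPacking S = IsPacking S × (∀ T → IsPacking T → S ⊆ T → T ⊆ S)

{-# OPTIONS --safe #-}
-- Write X for the set of neighbours of S; by maximality every vertex outside S ∪ X (a "far" vertex)
-- has a neighbour in X. Call s ∈ S saturated if it has degree 3 and all its neighbours have far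
-- neighbours. Each neighbour of a saturated vertex has at most one neighbour in X, which yields an
-- independent set A₀ ⊆ X dominating all saturated vertices. Extend A₀ greedily to a maximal independent
-- subset of X and then to a maximal independent set I of G. Move each far vertex of I to one of its
-- neighbours in X and fix the other vertices of I. This map is injective: a vertex of X outside I has
-- neighbours in S and in I ∩ X, hence at most one far neighbour. At most three of its values lie in the
-- closed neighbourhood of any s ∈ S: if s itself is a value then s ∈ I is not saturated, so s has degree
-- at most 2 or has a neighbour that is not a value.
module Submission where

open import Defs
open import Data.Bool using (true)
open import Data.Bool.Properties using () renaming (_≟_ to _≟ᵇ_)
open import Data.Empty using (⊥-elim)
open import Data.Fin using (Fin; zero; suc; _≟_)
open import Data.Fin.Properties using (any?; suc-injective)
open import Data.Fin.Subset using (Subset; inside; outside; _∈_; _∉_; _⊆_; _∪_; _-_; ⁅_⁆; ∣_∣; Nonempty)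
  renaming (⊥ to ∅)
open import Data.Fin.Subset.Properties
open import Data.List using (List; []; _∷_; allFin; filter)
open import Data.List.Membership.Propositional using () renaming (_∈_ to _∈ₗ_)
open import Data.List.Membership.Propositional.Properties using (∈-allFin; ∈-filter⁺; ∈-filter⁻)
open import Data.List.Relation.Unary.Any using (here; there)
open import Data.Nat using (ℕ; zero; suc; _+_; _*_; _≤_; _<_; _≤?_; z≤n; s≤s; s≤s⁻¹)
open import Data.Nat.Properties hiding (_≟_; suc-injective)
open import Data.Product using (_×_; _,_; ∃; ∃-syntax; proj₁; proj₂)
open import Data.Sum using (_⊎_; inj₁; inj₂; [_,_]′)
open import Data.Vec using ([]; _∷_; here; there; tabulate)
open import Data.Vec.Properties using ([]=⇒lookup; lookup⇒[]=; lookup∘tabulate)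
open import Function using (_∘_; id)
open import Relation.Binary.PropositionalEquality
open import Relation.Nullary using (¬_; Dec; yes; no; does; contradiction)
open import Relation.Nullary.Decidable using (_×-dec_; ¬?; dec-true; decidable-stable)
open import Relation.Unary using (Pred; Decidable)
open import Level using (0ℓ)

private variable
  m n k : ℕ

-- Finite subsets: comprehension, cardinality bounds and covers.

∈-tabulate⁺ : ∀ {f} {v : Fin n} → f v ≡ true → v ∈ tabulate f
∈-tabulate⁺ {f = f} {v} fv = lookup⇒[]= v _ (trans (lookup∘tabulate f v) fv)

∈-tabulate⁻ : ∀ {f} {v : Fin n} → v ∈ tabulate f → f v ≡ true
∈-tabulate⁻ {f = f} {v} v∈ = trans (sym (lookup∘tabulate f v)) ([]=⇒lookup v∈)

comprehension : {P : Pred (Fin n) 0ℓ} → Decidable P → Subset n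
comprehension P? = tabulate (does ∘ P?)

module _ {P : Pred (Fin n) 0ℓ} (P? : Decidable P) where

  ∈-comprehension⁺ : ∀ {v} → P v → v ∈ comprehension P?
  ∈-comprehension⁺ {v} Pv = ∈-tabulate⁺ (dec-true (P? v) Pv)

  ∈-comprehension⁻ : ∀ {v} → v ∈ comprehension P? → P v
  ∈-comprehension⁻ {v} v∈ with P? v | ∈-tabulate⁻ {f = does ∘ P?} v∈
  ... | yes Pv | _  = Pv

∣p∪q∣≤∣p∣+∣q∣ : (p q : Subset n) → ∣ p ∪ q ∣ ≤ ∣ p ∣ + ∣ q ∣
∣p∪q∣≤∣p∣+∣q∣ []            []            = z≤n
∣p∪q∣≤∣p∣+∣q∣ (outside ∷ p) (outside ∷ q) = ∣p∪q∣≤∣p∣+∣q∣ p q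
∣p∪q∣≤∣p∣+∣q∣ (outside ∷ p) (inside ∷ q)
  rewrite +-suc ∣ p ∣ ∣ q ∣ = s≤s (∣p∪q∣≤∣p∣+∣q∣ p q)
∣p∪q∣≤∣p∣+∣q∣ (inside ∷ p) (outside ∷ q) = s≤s (∣p∪q∣≤∣p∣+∣q∣ p q)
∣p∪q∣≤∣p∣+∣q∣ (inside ∷ p) (inside ∷ q)
  rewrite +-suc ∣ p ∣ ∣ q ∣ = s≤s (m≤n⇒m≤1+n (∣p∪q∣≤∣p∣+∣q∣ p q))

∣⁅x⁆∪p∣≤1+∣p∣ : ∀ (x : Fin n) p → ∣ ⁅ x ⁆ ∪ p ∣ ≤ suc ∣ p ∣
∣⁅x⁆∪p∣≤1+∣p∣ x p = subst (λ c → ∣ ⁅ x ⁆ ∪ p ∣ ≤ c + ∣ p ∣) (∣⁅x⁆∣≡1 x) (∣p∪q∣≤∣p∣+∣q∣ ⁅ x ⁆ p)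

∣p∣≤1+∣p-x∣ : ∀ (p : Subset n) x → ∣ p ∣ ≤ suc ∣ p - x ∣
∣p∣≤1+∣p-x∣ p x = ≤-trans (p⊆q⇒∣p∣≤∣q∣ p⊆) (∣⁅x⁆∪p∣≤1+∣p∣ x (p - x))
  where
  p⊆ : p ⊆ ⁅ x ⁆ ∪ (p - x)
  p⊆ {y} y∈p with y ≟ x
  ... | yes refl = p⊆p∪q _ (x∈⁅x⁆ x)
  ... | no  y≢x  = q⊆p∪q ⁅ x ⁆ _ (x∈p∧x≢y⇒x∈p-y y∈p y≢x)

x∉p-x : ∀ (x : Fin n) p → x ∉ p - x
x∉p-x zero    (_ ∷ _) ()
x∉p-x (suc x) (_ ∷ p) (there x∈) = x∉p-x x p x∈

0<∣p∣⇒Nonempty : (p : Subset n) → 0 < ∣ p ∣ → Nonempty p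
0<∣p∣⇒Nonempty (inside ∷ p)  _  = zero , here
0<∣p∣⇒Nonempty (outside ∷ p) 0< with x , x∈p ← 0<∣p∣⇒Nonempty p 0< = suc x , there x∈p

∣p∣>1⇒∃≢ : ∀ (p : Subset n) x → 1 < ∣ p ∣ → ∃[ y ] (y ∈ p × y ≢ x)
∣p∣>1⇒∃≢ p x 1<∣p∣ with 0<∣p∣⇒Nonempty (p - x) (s≤s⁻¹ (≤-trans 1<∣p∣ (∣p∣≤1+∣p-x∣ p x)))
... | y , y∈p-x = y , p─q⊆p p ⁅ x ⁆ y∈p-x , λ { refl → x∉p-x x p y∈p-x }

four-distinct⇒∣p∣>3 : ∀ {p : Subset n} {a b c d} → a ∈ p → b ∈ p → c ∈ p → d ∈ p →
  a ≢ b → a ≢ c → a ≢ d → b ≢ c → b ≢ d → c ≢ d → 3 < ∣ p ∣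
four-distinct⇒∣p∣>3 {p = p} {a} {b} {c} {d} a∈ b∈ c∈ d∈ a≢b a≢c a≢d b≢c b≢d c≢d =
  ≤-<-trans (≤-<-trans (≤-<-trans (≤-<-trans z≤n
    (x∈p⇒∣p-x∣<∣p∣ {x = a} {p - d - c - b} (a∈ ∖ a≢d ∖ a≢c ∖ a≢b)))
    (x∈p⇒∣p-x∣<∣p∣ (b∈ ∖ b≢d ∖ b≢c)))
    (x∈p⇒∣p-x∣<∣p∣ (c∈ ∖ c≢d)))
    (x∈p⇒∣p-x∣<∣p∣ d∈)
  where
  infixl 5 _∖_
  _∖_ : ∀ {q : Subset _} {x y} → x ∈ q → x ≢ y → x ∈ q - y
  _∖_ = x∈p∧x≢y⇒x∈p-y

injection⇒∣p∣≤∣q∣ : (p : Subset m) (q : Subset n) (f : Fin m → Fin n) →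
  (∀ {x} → x ∈ p → f x ∈ q) →
  (∀ {x y} → x ∈ p → y ∈ p → f x ≡ f y → x ≡ y) → ∣ p ∣ ≤ ∣ q ∣
injection⇒∣p∣≤∣q∣ []            q f f∈ inj = z≤n
injection⇒∣p∣≤∣q∣ (outside ∷ p) q f f∈ inj =
  injection⇒∣p∣≤∣q∣ p q (f ∘ suc) (f∈ ∘ there)
    (λ x∈ y∈ → suc-injective ∘ inj (there x∈) (there y∈))
injection⇒∣p∣≤∣q∣ (inside ∷ p) q f f∈ inj =
  ≤-trans (s≤s (injection⇒∣p∣≤∣q∣ p (q - f zero) (f ∘ suc)
    (λ x∈ → x∈p∧x≢y⇒x∈p-y (f∈ (there x∈)) (λ eq → contradiction (inj (there x∈) here eq) λ ()))
    (λ x∈ y∈ → suc-injective ∘ inj (there x∈) (there y∈))))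
    (x∈p⇒∣p-x∣<∣p∣ (f∈ here))

-- The predicates `P s` come with no decision procedure, so their union is bounded through an
-- explicit cover `C`.
bounded-union : (S : Subset m) (P : Fin m → Pred (Fin n) 0ℓ) →
  (∀ {s} → s ∈ S → ∃[ C ] (∣ C ∣ ≤ k × (∀ {v} → P s v → v ∈ C))) →
  ∃[ C ] (∣ C ∣ ≤ k * ∣ S ∣ × (∀ {s v} → s ∈ S → P s v → v ∈ C))
bounded-union {n = n} [] P cover = ∅ , ≤-trans (≤-reflexive (∣⊥∣≡0 n)) z≤n , λ ()
bounded-union (outside ∷ S) P cover
  with C , ∣C∣≤ , C∋ ← bounded-union S (P ∘ suc) (cover ∘ there) =
  C , ∣C∣≤ , λ { (there s∈S) → C∋ s∈S }
bounded-union {k = k} (inside ∷ S) P cover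
  with C , ∣C∣≤ , C∋ ← bounded-union S (P ∘ suc) (cover ∘ there) | D , ∣D∣≤ , D∋ ← cover here =
    D ∪ C
  , ≤-trans (∣p∪q∣≤∣p∣+∣q∣ D C)
      (≤-trans (+-mono-≤ ∣D∣≤ ∣C∣≤) (≤-reflexive (sym (*-suc k ∣ S ∣))))
  , λ { here Pv → p⊆p∪q C (D∋ Pv) ; (there s∈S) Pv → q⊆p∪q D C (C∋ s∈S Pv) }

-- Adjacency, domination and greedy independent extension.

module _ (G : Graph n) where

  Adj? : ∀ u v → Dec (Adj G u v)
  Adj? u v = Graph.adj G u v ≟ᵇ true

  Adj-sym : ∀ {u v} → Adj G u v → Adj G v u
  Adj-sym {u} {v} = trans (Graph.sym G v u)

  Adj-irrefl : ∀ {v} → ¬ Adj G v v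
  Adj-irrefl {v} vv with () ← trans (sym vv) (Graph.irrefl G v)

  Adj⇒∈N : ∀ {u v} → Adj G u v → v ∈ N G u
  Adj⇒∈N = ∈-tabulate⁺

  ∈N⇒Adj : ∀ {u v} → v ∈ N G u → Adj G u v
  ∈N⇒Adj = ∈-tabulate⁻

  four-neighbours⇒3<degree : ∀ {v a b c d} → Adj G v a → Adj G v b → Adj G v c → Adj G v d →
    a ≢ b → a ≢ c → a ≢ d → b ≢ c → b ≢ d → c ≢ d → 3 < degree G v
  four-neighbours⇒3<degree va vb vc vd =
    four-distinct⇒∣p∣>3 (Adj⇒∈N va) (Adj⇒∈N vb) (Adj⇒∈N vc) (Adj⇒∈N vd)

  Dominates : Subset n → Fin n → Set
  Dominates A v = v ∈ A ⊎ (∃[ a ] (a ∈ A × Adj G a v))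

  Dominates-mono : ∀ {A B v} → A ⊆ B → Dominates A v → Dominates B v
  Dominates-mono A⊆B (inj₁ v∈A)            = inj₁ (A⊆B v∈A)
  Dominates-mono A⊆B (inj₂ (a , a∈A , av)) = inj₂ (a , A⊆B a∈A , av)

  insert-independent : ∀ {A v} → IsIndependent G A → (∀ {a} → a ∈ A → ¬ Adj G v a) →
    IsIndependent G (A ∪ ⁅ v ⁆)
  insert-independent {A} {v} indep v≁A x y x∈ y∈ xy
    with x∈p∪q⁻ A ⁅ v ⁆ x∈ | x∈p∪q⁻ A ⁅ v ⁆ y∈
  ... | inj₁ x∈A | inj₁ y∈A = indep x y x∈A y∈A xy
  ... | inj₁ x∈A | inj₂ y∈v with refl ← x∈⁅y⁆⇒x≡y v y∈v = v≁A x∈A (Adj-sym xy)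
  ... | inj₂ x∈v | inj₁ y∈A with refl ← x∈⁅y⁆⇒x≡y v x∈v = v≁A y∈A xy
  ... | inj₂ x∈v | inj₂ y∈v
    with refl ← x∈⁅y⁆⇒x≡y v x∈v | refl ← x∈⁅y⁆⇒x≡y v y∈v = Adj-irrefl xy

  -- Each listed vertex is inserted unless the current set already contains a neighbour of it;
  -- either way it stays dominated as the set grows. Tracking the origin of `b` keeps a run over
  -- near vertices among the near vertices.
  greedy-extension : ∀ {A} → IsIndependent G A → (vs : List (Fin n)) →
    ∃[ B ] (IsIndependent G B × A ⊆ B × (∀ {b} → b ∈ B → b ∈ A ⊎ b ∈ₗ vs)
            × (∀ {v} → v ∈ₗ vs → Dominates B v))
  greedy-extension {A} indep [] = A , indep , id , inj₁ , λ ()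
  greedy-extension {A} indep (v ∷ vs)
    with any? (λ a → (a ∈? A) ×-dec Adj? a v)
  ... | yes dom
    with B , indepB , A⊆B , B⊆ , domB ← greedy-extension indep vs =
      B , indepB , A⊆B , [ inj₁ , inj₂ ∘ there ]′ ∘ B⊆
    , λ { (here refl) → Dominates-mono A⊆B (inj₂ dom) ; (there v∈) → domB v∈ }
  ... | no ¬dom
    with B , indepB , A'⊆B , B⊆ , domB ← greedy-extension
           (insert-independent indep (λ a∈A va → ¬dom (_ , a∈A , Adj-sym va))) vs =
      B , indepB , A'⊆B ∘ p⊆p∪q _ , from ∘ B⊆
    , λ { (here refl) → inj₁ (A'⊆B (q⊆p∪q A _ (x∈⁅x⁆ v))) ; (there v∈) → domB v∈ }
    where
    from : ∀ {b} → b ∈ A ∪ ⁅ v ⁆ ⊎ b ∈ₗ vs → b ∈ A ⊎ b ∈ₗ v ∷ vs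
    from (inj₂ b∈vs) = inj₂ (there b∈vs)
    from (inj₁ b∈) with x∈p∪q⁻ A ⁅ v ⁆ b∈
    ... | inj₁ b∈A = inj₁ b∈A
    ... | inj₂ b∈v = inj₂ (here (x∈⁅y⁆⇒x≡y v b∈v))

  -- Independent transversals of disjoint neighbourhoods.

  IsIndependentTransversal : Subset n → Subset n → Set
  IsIndependentTransversal U A = IsIndependent G A
    × (∀ {a} → a ∈ A → ∃[ s ] (s ∈ U × Adj G s a))
    × (∀ {s} → s ∈ U → ∃[ a ] (a ∈ A × Adj G s a))

  ∅-transversal : ∀ {U} → ¬ Nonempty U → IsIndependentTransversal U ∅
  ∅-transversal U-empty =
    (λ _ _ u∈ → ⊥-elim (∉⊥ u∈)) , ⊥-elim ∘ ∉⊥ , λ s∈U → ⊥-elim (U-empty (_ , s∈U))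

  -- The neighbourhoods of the vertices of `T` are disjoint classes of size at least two, and by
  -- `partner` each vertex in their union has at most one neighbour in that union. Choosing one
  -- vertex per class then rules out at most one later choice.
  module _ (T : Subset n)
    (disjoint : ∀ {s t v} → s ∈ T → t ∈ T → Adj G s v → Adj G t v → s ≡ t)
    (large : ∀ {s} → s ∈ T → 1 < degree G s)
    (partner : ∀ {s v} → s ∈ T → Adj G s v →
               ∃[ z ] (∀ {t w} → t ∈ T → Adj G t w → Adj G v w → w ≡ z))
    where

    -- Banning a vertex z keeps the induction going: serving the vertex adjacent to z first, by some
    -- v ≠ z, makes z harmless, and leaves the partner of v as the only vertex to be banned.
    independent-transversal : ∀ k U → ∣ U ∣ ≤ k → U ⊆ T → ∀ z →
      ∃[ A ] (z ∉ A × IsIndependentTransversal U A)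
    independent-transversal k U ∣U∣≤k U⊆T z with nonempty? U
    ... | no U-empty = ∅ , ∉⊥ , ∅-transversal U-empty
    ... | yes (s₀ , s₀∈U) = step k ∣U∣≤k first
      where
      first : ∃[ s ] (s ∈ U × (∀ {t} → t ∈ U → Adj G t z → t ≡ s))
      first with any? (λ s → (s ∈? U) ×-dec Adj? s z)
      ... | yes (s , s∈U , sz) = s , s∈U , λ t∈U tz → disjoint (U⊆T t∈U) (U⊆T s∈U) tz sz
      -- Without a neighbour of `z` in `U` the uniqueness clause is vacuous, so any element of `U`
      -- may be served first.
      ... | no none            = s₀ , s₀∈U , λ t∈U tz → ⊥-elim (none (_ , t∈U , tz))

      step : ∀ k → ∣ U ∣ ≤ k → ∃[ s ] (s ∈ U × (∀ {t} → t ∈ U → Adj G t z → t ≡ s)) →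
        ∃[ A ] (z ∉ A × IsIndependentTransversal U A)
      step zero ∣U∣≤0 (s , s∈U , _) = contradiction (<-≤-trans (x∈p⇒∣p-x∣<∣p∣ s∈U) ∣U∣≤0) λ ()
      step (suc k) ∣U∣≤ (s , s∈U , only-s)
        with v , v∈Ns , v≢z ← ∣p∣>1⇒∃≢ (N G s) z (large (U⊆T s∈U))
        with z' , only-z' ← partner (U⊆T s∈U) (∈N⇒Adj v∈Ns)
        with A , z'∉A , indep , A⊆ , serves ←
          independent-transversal k (U - s)
            (s≤s⁻¹ (<-≤-trans (x∈p⇒∣p-x∣<∣p∣ s∈U) ∣U∣≤)) (U⊆T ∘ p─q⊆p U ⁅ s ⁆) z' =
          A ∪ ⁅ v ⁆
        , z∉
        , insert-independent indep v≁A
        , A'⊆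
        , serves'
        where
        U-s⊆U : U - s ⊆ U
        U-s⊆U = p─q⊆p U ⁅ s ⁆

        -- A neighbour of `v` in `A` lies next to some `t` in `U - s`, so it is the partner `z'`,
        -- which was banned from `A`.
        v≁A : ∀ {a} → a ∈ A → ¬ Adj G v a
        v≁A a∈A va with t , t∈ , ta ← A⊆ a∈A =
          z'∉A (subst (_∈ A) (only-z' (U⊆T (U-s⊆U t∈)) ta va) a∈A)

        z∉ : z ∉ A ∪ ⁅ v ⁆
        z∉ z∈ with x∈p∪q⁻ A ⁅ v ⁆ z∈
        ... | inj₂ z∈v = v≢z (sym (x∈⁅y⁆⇒x≡y v z∈v))
        ... | inj₁ z∈A with t , t∈ , tz ← A⊆ z∈A with refl ← only-s (U-s⊆U t∈) tz = x∉p-x s U t∈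

        A'⊆ : ∀ {a} → a ∈ A ∪ ⁅ v ⁆ → ∃[ t ] (t ∈ U × Adj G t a)
        A'⊆ a∈ with x∈p∪q⁻ A ⁅ v ⁆ a∈
        ... | inj₂ a∈v with refl ← x∈⁅y⁆⇒x≡y v a∈v = s , s∈U , ∈N⇒Adj v∈Ns
        ... | inj₁ a∈A with t , t∈ , ta ← A⊆ a∈A = t , U-s⊆U t∈ , ta

        serves' : ∀ {t} → t ∈ U → ∃[ a ] (a ∈ A ∪ ⁅ v ⁆ × Adj G t a)
        serves' {t} t∈U with t ≟ s
        ... | yes refl = v , q⊆p∪q A _ (x∈⁅x⁆ v) , ∈N⇒Adj v∈Ns
        ... | no t≢s with a , a∈A , ta ← serves (x∈p∧x≢y⇒x∈p-y t∈U t≢s) = a , p⊆p∪q _ a∈A , ta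

  -- Near, far and saturated vertices of a maximal packing.

  module _ (Δ≤3 : MaxDegreeAtMost G 3) (S : Subset n) (maximal : IsMaximalPacking G S) where

    packing-disjoint : ∀ {s t v} → s ∈ S → t ∈ S → InClosedNbhd G v s → InClosedNbhd G v t → s ≡ t
    packing-disjoint {s} {t} s∈S t∈S v∈s v∈t =
      decidable-stable (s ≟ t) λ s≢t → proj₁ maximal s t s∈S t∈S s≢t _ (v∈s , v∈t)

    Near Far : Fin n → Set
    Near v = ∃[ s ] (s ∈ S × Adj G s v)
    Far v = v ∉ S × ¬ Near v

    Near? : Decidable Near
    Near? v = any? λ s → (s ∈? S) ×-dec Adj? s v

    Near⇒∉S : ∀ {v} → Near v → v ∉ S
    Near⇒∉S (s , s∈S , sv) v∈S
      with refl ← packing-disjoint s∈S v∈S (inj₂ sv) (inj₁ refl) = Adj-irrefl sv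

    -- Otherwise no closed neighbourhood of a packing vertex meets that of `v`, so `S ∪ ⁅ v ⁆` is a
    -- packing and maximality puts `v` in `S`.
    far⇒near-neighbour : ∀ {v} → Far v → ∃[ x ] (Near x × Adj G v x)
    far⇒near-neighbour {v} (v∉S , v-not-near) with any? (λ x → Near? x ×-dec Adj? v x)
    ... | yes found = found
    ... | no none   = ⊥-elim (v∉S (proj₂ maximal (S ∪ ⁅ v ⁆) packing (p⊆p∪q _) (q⊆p∪q S _ (x∈⁅x⁆ v))))
      where
      apart : ∀ {u w} → u ∈ S → InClosedNbhd G w u → ¬ InClosedNbhd G w v
      apart u∈S (inj₁ refl) (inj₁ refl) = v∉S u∈S
      apart u∈S (inj₂ uw)   (inj₁ refl) = v-not-near (_ , u∈S , uw)
      apart u∈S (inj₁ refl) (inj₂ vw)   = v-not-near (_ , u∈S , Adj-sym vw)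
      apart u∈S (inj₂ uw)   (inj₂ vw)   = none (_ , (_ , u∈S , uw) , vw)

      packing : IsPacking G (S ∪ ⁅ v ⁆)
      packing x y x∈ y∈ x≢y w (w∈x , w∈y) with x∈p∪q⁻ S ⁅ v ⁆ x∈ | x∈p∪q⁻ S ⁅ v ⁆ y∈
      ... | inj₁ x∈S | inj₁ y∈S = proj₁ maximal x y x∈S y∈S x≢y w (w∈x , w∈y)
      ... | inj₁ x∈S | inj₂ y∈v with refl ← x∈⁅y⁆⇒x≡y v y∈v = apart x∈S w∈x w∈y
      ... | inj₂ x∈v | inj₁ y∈S with refl ← x∈⁅y⁆⇒x≡y v x∈v = apart y∈S w∈y w∈x
      ... | inj₂ x∈v | inj₂ y∈v = x≢y (trans (x∈⁅y⁆⇒x≡y v x∈v) (sym (x∈⁅y⁆⇒x≡y v y∈v)))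

    HasFarNeighbour : Fin n → Set
    HasFarNeighbour v = ∃[ y ] (Far y × Adj G v y)

    HasFarNeighbour? : Decidable HasFarNeighbour
    HasFarNeighbour? v = any? λ y → (¬? (y ∈? S) ×-dec ¬? (Near? y)) ×-dec Adj? v y

    Unsaturating : Fin n → Fin n → Set
    Unsaturating s v = Adj G s v × ¬ HasFarNeighbour v

    Unsaturating? : ∀ s → Decidable (Unsaturating s)
    Unsaturating? s v = Adj? s v ×-dec ¬? (HasFarNeighbour? v)

    -- Under `Δ≤3` the degree is exactly 3. The negated existential is decidable, and its failure
    -- yields a concrete neighbour without far neighbours.
    Saturated : Fin n → Set
    Saturated s = s ∈ S × 2 < degree G s × ¬ ∃ (Unsaturating s)

    Saturated? : Decidable Saturated
    Saturated? s = (s ∈? S) ×-dec (3 ≤? degree G s) ×-dec ¬? (any? (Unsaturating? s))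

    -- Packing, near and far vertices form disjoint classes, so `s`, `y`, `x`, `x'` would be four
    -- distinct neighbours of `v`.
    near-neighbour-unique : ∀ {v y x x'} → Near v → Far y → Adj G v y →
      Near x → Adj G v x → Near x' → Adj G v x' → x ≡ x'
    near-neighbour-unique {x = x} {x'} (s , s∈S , sv) (y∉S , y-not-near) vy near-x vx near-x' vx' =
      decidable-stable (x ≟ x') λ x≢x' → <⇒≱
        (four-neighbours⇒3<degree (Adj-sym sv) vy vx vx'
          (λ { refl → y∉S s∈S }) (λ { refl → Near⇒∉S near-x s∈S }) (λ { refl → Near⇒∉S near-x' s∈S })
          (λ { refl → y-not-near near-x }) (λ { refl → y-not-near near-x' }) x≢x')
        (Δ≤3 _)

    -- The same count, with one packing, one near and two far neighbours.
    far-neighbour-unique : ∀ {v x y y'} → Near v → Near x → Adj G v x →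
      Far y → Adj G v y → Far y' → Adj G v y' → y ≡ y'
    far-neighbour-unique {y = y} {y'} (s , s∈S , sv) near-x vx
      (y∉S , y-not-near) vy (y'∉S , y'-not-near) vy' =
      decidable-stable (y ≟ y') λ y≢y' → <⇒≱
        (four-neighbours⇒3<degree (Adj-sym sv) vx vy vy'
          (λ { refl → Near⇒∉S near-x s∈S }) (λ { refl → y∉S s∈S }) (λ { refl → y'∉S s∈S })
          (λ { refl → y-not-near near-x }) (λ { refl → y'-not-near near-x }) y≢y')
        (Δ≤3 _)

    saturated-transversal : ∃ (IsIndependentTransversal (comprehension Saturated?))
    saturated-transversal = from (nonempty? T)
      where
      T : Subset n
      T = comprehension Saturated?

      saturated : ∀ {s} → s ∈ T → Saturated s
      saturated = ∈-comprehension⁻ Saturated?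

      partner : ∀ {s v} → s ∈ T → Adj G s v →
        ∃[ z ] (∀ {t w} → t ∈ T → Adj G t w → Adj G v w → w ≡ z)
      partner {s} {v} s∈T sv with any? (λ x → Near? x ×-dec Adj? v x)
      -- Here `v` is a dummy partner: every competing `w` would be a near neighbour of `v`, and
      -- there is none.
      ... | no none = v , λ t∈T tw vw → ⊥-elim (none (_ , (_ , proj₁ (saturated t∈T) , tw) , vw))
      ... | yes (x , near-x , vx) with s∈S , _ , none ← saturated s∈T
        with y , far-y , vy ← decidable-stable (HasFarNeighbour? v) (λ ¬far → none (v , sv , ¬far)) =
          x , λ t∈T tw vw → near-neighbour-unique (s , s∈S , sv) far-y vy
                              (_ , proj₁ (saturated t∈T) , tw) vw near-x vx

      from : Dec (Nonempty T) → ∃ (IsIndependentTransversal T)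
      from (no T-empty)  = ∅ , ∅-transversal T-empty
      -- A vertex to ban must be supplied; any will do, and nonemptiness of `T` provides one.
      from (yes (z , _))
        with A , _ , transversal ← independent-transversal T
          (λ s∈T t∈T sv tv →
            packing-disjoint (proj₁ (saturated s∈T)) (proj₁ (saturated t∈T)) (inj₂ sv) (inj₂ tv))
          (λ s∈T → <-trans (s≤s (s≤s z≤n)) (proj₁ (proj₂ (saturated s∈T))))
          partner ∣ T ∣ T ≤-refl id z =
          A , transversal

    -- Counting the independent set by slots around the packing.

    independent-dominating-bound : ∀ {I} → IsIndependent G I →
      (∀ {x} → Near x → x ∈ I ⊎ (∃[ a ] (a ∈ I × Near a × Adj G a x))) →
      (∀ {s} → s ∈ I → ¬ Saturated s) →
      ∣ I ∣ ≤ 3 * ∣ S ∣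
    independent-dominating-bound {I} indep near-dominated unsaturated =
      ≤-trans (injection⇒∣p∣≤∣q∣ I C f f∈C f-injective) (proj₁ (proj₂ covering))
      where
      data Slotted (v w : Fin n) : Set where
        centre : v ∈ S → w ≡ v → Slotted v w
        near   : Near v → w ≡ v → Slotted v w
        far    : Far v → Near w → Adj G v w → Slotted v w

      slot : ∀ v → ∃[ w ] Slotted v w
      slot v with v ∈? S | Near? v
      ... | yes v∈S | _          = v , centre v∈S refl
      ... | no  _   | yes near-v = v , near near-v refl
      ... | no  v∉S | no ¬near-v with x , near-x , vx ← far⇒near-neighbour (v∉S , ¬near-v) =
        x , far (v∉S , ¬near-v) near-x vx

      f : Fin n → Fin n
      f v = proj₁ (slot v)

      -- Every near neighbour of a far vertex of `I` counts, not only the one picked by `slot`; the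
      -- bound of three per packing vertex holds even so.
      Slot : Fin n → Fin n → Set
      Slot s w = (∃[ v ] (v ∈ I × Slotted v w)) × InClosedNbhd G w s

      Slotted-injective : ∀ {u v w} → u ∈ I → v ∈ I → Slotted u w → Slotted v w → u ≡ v
      Slotted-injective u∈ v∈ (centre _ refl) (centre _ refl) = refl
      Slotted-injective u∈ v∈ (centre _ refl) (near _ refl)   = refl
      Slotted-injective u∈ v∈ (near _ refl)   (centre _ refl) = refl
      Slotted-injective u∈ v∈ (near _ refl)   (near _ refl)   = refl
      Slotted-injective u∈ v∈ (centre _ refl) (far _ _ vw)    = ⊥-elim (indep _ _ v∈ u∈ vw)
      Slotted-injective u∈ v∈ (near _ refl)   (far _ _ vw)    = ⊥-elim (indep _ _ v∈ u∈ vw)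
      Slotted-injective u∈ v∈ (far _ _ uw)    (centre _ refl) = ⊥-elim (indep _ _ u∈ v∈ uw)
      Slotted-injective u∈ v∈ (far _ _ uw)    (near _ refl)   = ⊥-elim (indep _ _ u∈ v∈ uw)
      -- Since `w` is adjacent to `u` in `I`, it lies outside `I` and is dominated by a near `a`.
      -- This leaves room for only one far neighbour.
      Slotted-injective u∈ v∈ (far far-u near-w uw) (far far-v _ vw) with near-dominated near-w
      ... | inj₁ w∈I                   = ⊥-elim (indep _ _ u∈ w∈I uw)
      ... | inj₂ (a , _ , near-a , aw) =
        far-neighbour-unique near-w near-a (Adj-sym aw) far-u (Adj-sym uw) far-v (Adj-sym vw)

      f-injective : ∀ {u v} → u ∈ I → v ∈ I → f u ≡ f v → u ≡ v
      f-injective {u} {v} u∈ v∈ fu≡fv =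
        Slotted-injective u∈ v∈ (proj₂ (slot u)) (subst (Slotted v) (sym fu≡fv) (proj₂ (slot v)))

      Slotted⇒closed-nbhd : ∀ {v w} → Slotted v w → ∃[ s ] (s ∈ S × InClosedNbhd G w s)
      Slotted⇒closed-nbhd (centre v∈S refl)          = _ , v∈S , inj₁ refl
      Slotted⇒closed-nbhd (near (s , s∈S , sv) refl) = s , s∈S , inj₂ sv
      Slotted⇒closed-nbhd (far _ (s , s∈S , sw) _)   = s , s∈S , inj₂ sw

      -- The closed neighbourhood of `s` has at most four elements. If it has four, one is no slot:
      -- `s` itself when `s` is outside `I`, otherwise an unsaturating neighbour.
      slots : ∀ {s} → s ∈ S → ∃[ C ] (∣ C ∣ ≤ 3 × (∀ {w} → Slot s w → w ∈ C))
      slots {s} s∈S with s ∈? I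
      ... | no s∉I = N G s , Δ≤3 s , λ where
        ((v , v∈ , centre _ refl)    , inj₁ refl) → ⊥-elim (s∉I v∈)
        ((v , v∈ , near _ refl)      , inj₁ refl) → ⊥-elim (s∉I v∈)
        ((v , v∈ , far _ near-s _)   , inj₁ refl) → ⊥-elim (Near⇒∉S near-s s∈S)
        (_                           , inj₂ sw)   → Adj⇒∈N sw
      ... | yes s∈I with 3 ≤? degree G s
      ...   | no ¬3≤ = ⁅ s ⁆ ∪ N G s
                     , ≤-trans (∣⁅x⁆∪p∣≤1+∣p∣ s (N G s)) (≰⇒> ¬3≤) , λ where
        (_ , inj₁ refl) → p⊆p∪q _ (x∈⁅x⁆ s)
        (_ , inj₂ sw)   → q⊆p∪q ⁅ s ⁆ _ (Adj⇒∈N sw)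
      ...   | yes 3≤
        with x , sx , ¬far-x ← decidable-stable (any? (Unsaturating? s))
                                 (λ none → unsaturated s∈I (s∈S , 3≤ , none)) =
          -- Deleting `x` pays for adding `s`.
          ⁅ s ⁆ ∪ (N G s - x)
        , ≤-trans (∣⁅x⁆∪p∣≤1+∣p∣ s (N G s - x))
            (<-≤-trans (x∈p⇒∣p-x∣<∣p∣ (Adj⇒∈N sx)) (Δ≤3 s))
        , λ where
            (_ , inj₁ refl)                → p⊆p∪q _ (x∈⁅x⁆ s)
            ((v , v∈ , slotted) , inj₂ sw) → q⊆p∪q ⁅ s ⁆ _
              (x∈p∧x≢y⇒x∈p-y (Adj⇒∈N sw) λ { refl → free v∈ slotted })
        where
        -- As a neighbour of `s` in `I`, `x` is not in `I`, so only a far vertex could be moved to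
        -- it, and `x` has no far neighbour.
        free : ∀ {v} → v ∈ I → ¬ Slotted v x
        free v∈ (centre _ refl)  = indep _ _ s∈I v∈ sx
        free v∈ (near _ refl)    = indep _ _ s∈I v∈ sx
        free v∈ (far far-v _ vx) = ¬far-x (_ , far-v , Adj-sym vx)

      covering : ∃[ C ] (∣ C ∣ ≤ 3 * ∣ S ∣ × (∀ {s w} → s ∈ S → Slot s w → w ∈ C))
      covering = bounded-union S Slot slots

      C : Subset n
      C = proj₁ covering

      f∈C : ∀ {v} → v ∈ I → f v ∈ C
      f∈C {v} v∈I with s , s∈S , near-s ← Slotted⇒closed-nbhd (proj₂ (slot v)) =
        proj₂ (proj₂ covering) s∈S ((v , v∈I , proj₂ (slot v)) , near-s)

    -- Construction of the independent dominating set.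

    small-independent-dominating : ∃[ I ] (IsIndependentDominating G I × ∣ I ∣ ≤ 3 * ∣ S ∣)
    small-independent-dominating
      with A₀ , indep₀ , A₀-saturated , A₀-serves ← saturated-transversal
      -- Near vertices are processed before all others, so each near vertex outside `I` has a near
      -- neighbour in `I`, as injectivity requires.
      with A , indepA , A₀⊆A , A-from , A-dom ← greedy-extension indep₀ (filter Near? (allFin n))
      with I , indepI , A⊆I , _ , I-dom ← greedy-extension indepA (allFin n) =
        I , ((λ v → I-dom (∈-allFin v)) , indepI)
      , independent-dominating-bound indepI near-dominated unsaturated
      where
      A₀-near : ∀ {a} → a ∈ A₀ → Near a
      A₀-near a∈A₀ with s , s∈T , sa ← A₀-saturated a∈A₀ =
        s , proj₁ (∈-comprehension⁻ Saturated? s∈T) , sa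

      A-near : ∀ {a} → a ∈ A → Near a
      A-near = [ A₀-near , (λ a∈ → proj₂ (∈-filter⁻ Near? {xs = allFin n} a∈)) ]′ ∘ A-from

      near-dominated : ∀ {x} → Near x → x ∈ I ⊎ (∃[ a ] (a ∈ I × Near a × Adj G a x))
      near-dominated {x} near-x with A-dom (∈-filter⁺ Near? (∈-allFin x) near-x)
      ... | inj₁ x∈A            = inj₁ (A⊆I x∈A)
      ... | inj₂ (a , a∈A , ax) = inj₂ (a , A⊆I a∈A , A-near a∈A , ax)

      unsaturated : ∀ {s} → s ∈ I → ¬ Saturated s
      unsaturated s∈I sat with a , a∈A₀ , sa ← A₀-serves (∈-comprehension⁺ Saturated? sat) =
        indepI _ a s∈I (A⊆I (A₀⊆A a∈A₀)) sa

theorem1 : ∀ {n : ℕ} (G : Graph n) → MaxDegreeAtMost G 3 →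
    ∀ (S : Subset n) → IsMaximalPacking G S →
    ∃[ A ] (IsIndependentDominating G A × ∣ A ∣ ≤ 3 * ∣ S ∣)
theorem1 = small-independent-dominating
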